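{- For every integer $n>1$, the cordial edge deficiency of the complete graph $K_n$ is $ced(K_n)=\left\lfloor \frac{n}{2}\right\rfloor-1$.
   Context: Graphs are finite and may have multiple edges but not loops. A binary labeling of a graph $G$ is a function $f:V(G)\to\{0,1\}$. Two real numbers $x,y$ are roughly equal if $0\le |x-y|\le 1$. A binary labeling $f$ is friendly if $|f^{ -1}(0)|$ and $|f^{ -1}(1)|$ are roughly equal. A binary labeling $f$ induces an edge labeling $f_e:E(G)\to\{0,1\}$ by $f_e(uv)=f(u)+f(v)$ modulo 2. A friendly labeling $f$ of $G$ is cordial if $|f_e^{ -1}(0)|$ and $|f_e^{ -1}(1)|$ are roughly equal. The cordial edge deficiency $ced(G)$ is the minimum, over all friendly labelings $f$ of $G$, of the number of edges that must be added to $G$ between pairs of distinct vertices of $G$ (multiple edges allowed) so that $f$ becomes a cordial labeling of the augmented graph $G'$. -}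

module Defs where

open import Data.Fin.Base using (Fin; toℕ)
open import Data.Fin.Patterns using (0F; 1F)
open import Data.Fin.Properties using (_≟_; _<?_; <⇒≢)
open import Data.List.Base using (List; _++_; length; filter; allFin; cartesianProduct)
open import Data.List.Relation.Unary.All using (All)
import Data.List.Relation.Unary.All as All
open import Data.List.Relation.Unary.All.Properties using (++⁺; all-filter)
open import Data.Nat.Base using (ℕ; _+_; _≤_; ∣_-_∣)
open import Data.Nat.DivMod using (_mod_)
open import Data.Product.Base using (_×_; _,_; ∃-syntax; Σ-syntax)
open import Relation.Binary.PropositionalEquality.Core using (_≡_; _≢_)

-- An edge is listed with an arbitrary order of its two endpoints; edge labels
-- do not depend on that order.  Repeated entries, in either order, are
-- parallel edges.
Distinct : ∀ {n} → Fin n × Fin n → Set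
Distinct (u , v) = u ≢ v

record Multigraph (n : ℕ) : Set where
  constructor multigraph
  field
    edges    : List (Fin n × Fin n)
    loopless : All Distinct edges

open Multigraph public

addEdges : ∀ {n} (G : Multigraph n) (es : List (Fin n × Fin n)) →
           All Distinct es → Multigraph n
addEdges G es distinct = multigraph (edges G ++ es) (++⁺ (loopless G) distinct)

complete : (n : ℕ) → Multigraph n
complete n = multigraph
  (filter (λ (i , j) → i <? j) pairs)
  (All.map <⇒≢ (all-filter (λ (i , j) → i <? j) pairs))
  where
  pairs : List (Fin n × Fin n)
  pairs = cartesianProduct (allFin n) (allFin n)

RoughlyEqual : ℕ → ℕ → Set
RoughlyEqual x y = ∣ x - y ∣ ≤ 1

Labeling : ℕ → Set
Labeling n = Fin n → Fin 2

edgeLabel : ∀ {n} → Labeling n → Fin n × Fin n → Fin 2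
edgeLabel f (u , v) = (toℕ (f u) + toℕ (f v)) mod 2

vertexCount : ∀ {n} → Labeling n → Fin 2 → ℕ
vertexCount {n} f b = length (filter (λ v → f v ≟ b) (allFin n))

edgeCount : ∀ {n} → Multigraph n → Labeling n → Fin 2 → ℕ
edgeCount G f b = length (filter (λ e → edgeLabel f e ≟ b) (edges G))

Friendly : ∀ {n} → Labeling n → Set
Friendly f = RoughlyEqual (vertexCount f 0F) (vertexCount f 1F)

Cordial : ∀ {n} → Multigraph n → Labeling n → Set
Cordial G f = Friendly f × RoughlyEqual (edgeCount G f 0F) (edgeCount G f 1F)

IsMinimum : (ℕ → Set) → ℕ → Set
IsMinimum P k = P k × (∀ m → P m → k ≤ m)

CordialAfterAdding : ∀ {n} → Multigraph n → Labeling n → ℕ → Set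
CordialAfterAdding {n} G f k =
  ∃[ es ] Σ[ distinct ∈ All Distinct es ]
    length es ≡ k × Cordial (addEdges G es distinct) f

-- A labeling that no addition of edges makes cordial has no number of required
-- edges, and so does not contribute to the outer minimum.
IsCordialEdgeDeficiency : ∀ {n} → Multigraph n → ℕ → Set
IsCordialEdgeDeficiency {n} G = IsMinimum λ k →
  Σ[ f ∈ Labeling n ] Friendly f × IsMinimum (CordialAfterAdding G f) k

{-# OPTIONS --safe #-}
-- If a friendly labeling has a vertices labeled 0 and b labeled 1, then
-- e₁ = ab and e₀ = C(a,2) + C(b,2), so 2(e₁ − e₀) = a + b − (a − b)²: every
-- friendly labeling of Kₙ has exactly ⌊n/2⌋ more 1-edges than 0-edges.  Hence at
-- least ⌊n/2⌋ − 1 edges are needed, and this many parallel 0-edges suffice.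
module Submission where

open import Defs
open import Data.Bool.Base using (true; false)
open import Data.Fin.Base using (Fin; suc; toℕ; opposite; _<_)
open import Data.Fin.Patterns using (0F; 1F; 2F)
open import Data.Fin.Properties using (_≟_; _<?_; opposite-involutive)
open import Data.List.Base
  using (List; []; _∷_; _++_; map; length; filter; allFin; replicate; cartesianProduct)
open import Data.List.Properties
  using (filter-++; filter-all; filter-none; filter-≐; length-++; length-filter; length-map;
         length-replicate; map-++; map-∘; map-tabulate)
open import Data.List.Relation.Unary.All as All using (All; []; _∷_; universal)
open import Data.List.Relation.Unary.All.Properties using (map⁺; replicate⁺)
open import Data.Nat.Base
  using (ℕ; zero; suc; _+_; _*_; _≤_; _>_; _∸_; ∣_-_∣; ⌊_/2⌋; z≤n; s≤s; s<s; s<s⁻¹; z<s)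
open import Data.Nat.DivMod using (_mod_)
open import Data.Nat.Properties
  using (+-identityʳ; +-suc; +-assoc; +-comm; +-cancelˡ-≡; *-cancelˡ-≡; 0≢1+n; ≤-reflexive;
         n≡⌊n+n/2⌋; n≡⌈n+n/2⌉; m≤n+∣n-m∣; m≤m+n; +-cancelˡ-≤; +-monoʳ-≤; ∸-monoˡ-≤; ∣m-m+n∣≡n;
         module ≤-Reasoning)
open import Data.Nat.Tactic.RingSolver using (solve-∀)
open import Data.Product.Base using (_×_; _,_)
import Data.Product.Base as Product
open import Data.Sum.Base using (_⊎_; inj₁; inj₂)
import Data.Sum.Base as Sum
open import Function.Base using (_∘_; id)
open import Relation.Binary.PropositionalEquality
  using (_≡_; refl; sym; trans; cong; cong₂; subst; module ≡-Reasoning)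
open import Relation.Nullary using (does)
open import Relation.Unary using (Decidable)

-- Filtering mapped and concatenated lists.

module _ {A B : Set} {P : B → Set} (P? : Decidable P) (g : A → B) where

  filter-map : ∀ xs → filter P? (map g xs) ≡ map g (filter (P? ∘ g) xs)
  filter-map []       = refl
  filter-map (x ∷ xs) with does (P? (g x))
  ... | false = filter-map xs
  ... | true  = cong (g x ∷_) (filter-map xs)

  length-filter-map : ∀ xs → length (filter P? (map g xs)) ≡ length (filter (P? ∘ g) xs)
  length-filter-map xs = trans (cong length (filter-map xs)) (length-map g (filter (P? ∘ g) xs))

length-filter-++ : ∀ {A : Set} {P : A → Set} (P? : Decidable P) xs ys →
  length (filter P? (xs ++ ys)) ≡ length (filter P? xs) + length (filter P? ys)
length-filter-++ P? xs ys =
  trans (cong length (filter-++ P? xs ys)) (length-++ (filter P? xs))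

-- The edges of a complete graph after splitting off vertex `0F`.

allFin-suc : ∀ n → allFin (suc n) ≡ 0F ∷ map suc (allFin n)
allFin-suc n = cong (0F ∷_) (sym (map-tabulate id suc))

sucPair : ∀ {n} → Fin n × Fin n → Fin (suc n) × Fin (suc n)
sucPair = Product.map suc suc

ascending? : ∀ {n} → Decidable {A = Fin n × Fin n} (λ (i , j) → i < j)
ascending? (i , j) = i <? j

filter-ascending-suc : ∀ {n} (es : List (Fin n × Fin n)) →
  filter ascending? (map sucPair es) ≡ map sucPair (filter ascending? es)
filter-ascending-suc es = trans (filter-map ascending? sucPair es)
  (cong (map sucPair) (filter-≐ (ascending? ∘ sucPair) ascending? (s<s⁻¹ , s<s) es))

-- No ascending pair ends in `0F`, so the head of each row is filtered out by computation, and `suc`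
-- preserves and reflects the order on the rest. Rows and columns are separate lists so that the
-- induction can consume `xs` while `ys` stays fixed.
filter-ascending-rows : ∀ {n} (xs ys : List (Fin n)) →
  filter ascending? (cartesianProduct (map suc xs) (0F ∷ map suc ys)) ≡
  map sucPair (filter ascending? (cartesianProduct xs ys))
filter-ascending-rows []       ys = refl
filter-ascending-rows (x ∷ xs) ys = begin
  filter ascending? (map (suc x ,_) (map suc ys) ++ rest)
    ≡⟨ filter-++ ascending? (map (suc x ,_) (map suc ys)) rest ⟩
  filter ascending? (map (suc x ,_) (map suc ys)) ++ filter ascending? rest
    ≡⟨ cong₂ _++_ firstRow (filter-ascending-rows xs ys) ⟩
  map sucPair (filter ascending? (map (x ,_) ys)) ++
  map sucPair (filter ascending? (cartesianProduct xs ys))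
    ≡⟨ map-++ sucPair (filter ascending? (map (x ,_) ys)) _ ⟨
  map sucPair (filter ascending? (map (x ,_) ys) ++ filter ascending? (cartesianProduct xs ys))
    ≡⟨ cong (map sucPair) (filter-++ ascending? (map (x ,_) ys) _) ⟨
  map sucPair (filter ascending? (cartesianProduct (x ∷ xs) ys)) ∎
  where
  open ≡-Reasoning
  rest = cartesianProduct (map suc xs) (0F ∷ map suc ys)
  firstRow : filter ascending? (map (suc x ,_) (map suc ys)) ≡
             map sucPair (filter ascending? (map (x ,_) ys))
  firstRow = trans
    -- The two maps are fused into one, then split again as `sucPair` after `(x ,_)`.
    (cong (filter ascending?) (trans (sym (map-∘ ys)) (map-∘ ys)))
    (filter-ascending-suc (map (x ,_) ys))

-- The row of `0F` loses only the pair `(0F , 0F)` and becomes a star; the other rows form a shifted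
-- copy of the smaller complete graph. This drives the induction on the number of vertices.
edges-complete-suc : ∀ n → edges (complete (suc n)) ≡
  map (λ j → 0F , suc j) (allFin n) ++ map sucPair (edges (complete n))
edges-complete-suc n = begin
  filter ascending? (cartesianProduct (allFin (suc n)) (allFin (suc n)))
    ≡⟨ cong (λ vs → filter ascending? (cartesianProduct vs vs)) (allFin-suc n) ⟩
  filter ascending? (map (0F ,_) (map suc vs) ++ rest)
    ≡⟨ filter-++ ascending? (map (0F ,_) (map suc vs)) rest ⟩
  filter ascending? (map (0F ,_) (map suc vs)) ++ filter ascending? rest
    ≡⟨ cong₂ _++_
         (trans (cong (filter ascending?) (sym (map-∘ vs)))
                (filter-all ascending? (map⁺ (universal (λ _ → z<s) vs))))
         (filter-ascending-rows vs vs) ⟩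
  map (λ j → 0F , suc j) vs ++ map sucPair (edges (complete n)) ∎
  where
  open ≡-Reasoning
  vs = allFin n
  rest = cartesianProduct (map suc vs) (0F ∷ map suc vs)

-- Vertex and edge counts by induction on the number of vertices.

edgeCount-complete-suc : ∀ {n} (f : Labeling (suc n)) b →
  edgeCount (complete (suc n)) f b ≡
  length (filter (λ j → edgeLabel f (0F , suc j) ≟ b) (allFin n)) +
  edgeCount (complete n) (f ∘ suc) b
edgeCount-complete-suc {n} f b = begin
  length (filter label? (edges (complete (suc n))))
    ≡⟨ cong (length ∘ filter label?) (edges-complete-suc n) ⟩
  length (filter label? (star ++ map sucPair (edges (complete n))))
    ≡⟨ length-filter-++ label? star _ ⟩
  length (filter label? star) + length (filter label? (map sucPair (edges (complete n))))
    -- The label of a shifted edge under `f` is, by computation, the label of the original edge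
    -- under `f ∘ suc`.
    ≡⟨ cong₂ _+_ (length-filter-map label? _ (allFin n))
                 (length-filter-map label? sucPair (edges (complete n))) ⟩
  length (filter (λ j → edgeLabel f (0F , suc j) ≟ b) (allFin n)) +
  edgeCount (complete n) (f ∘ suc) b ∎
  where
  open ≡-Reasoning
  label? : Decidable (λ e → edgeLabel f e ≡ b)
  label? e = edgeLabel f e ≟ b
  star = map (λ j → 0F , suc j) (allFin n)

0+toℕ-mod2 : ∀ (x : Fin 2) → (0 + toℕ x) mod 2 ≡ x
0+toℕ-mod2 0F = refl
0+toℕ-mod2 1F = refl

1+toℕ-mod2 : ∀ (x : Fin 2) → (1 + toℕ x) mod 2 ≡ opposite x
1+toℕ-mod2 0F = refl
1+toℕ-mod2 1F = refl

-- A center labeled 0 gives each star edge the label of its outer endpoint. The literal 0 is what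
-- `toℕ (f 0F)` becomes once `f 0F` is matched.
starCount₀ : ∀ {n} (f : Labeling n) b →
  length (filter (λ j → (0 + toℕ (f j)) mod 2 ≟ b) (allFin n)) ≡ vertexCount f b
starCount₀ {n} f b = cong length (filter-≐ _ _
  ( (λ {j} eq → trans (sym (0+toℕ-mod2 (f j))) eq)
  , (λ {j} eq → trans (0+toℕ-mod2 (f j)) eq)) (allFin n))

-- A center labeled 1 flips the label of the outer endpoint, and on `Fin 2` the flip is the
-- involution `opposite`.
starCount₁ : ∀ {n} (f : Labeling n) b →
  length (filter (λ j → (1 + toℕ (f j)) mod 2 ≟ b) (allFin n)) ≡ vertexCount f (opposite b)
starCount₁ {n} f b = cong length (filter-≐ _ _
  ( (λ {j} eq → trans (sym (opposite-involutive (f j)))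
                  (cong opposite (trans (sym (1+toℕ-mod2 (f j))) eq)))
  , (λ {j} eq → trans (1+toℕ-mod2 (f j))
                  (trans (cong opposite eq) (opposite-involutive b)))) (allFin n))

-- The share of vertex `0F` is kept as a filtered singleton, which computes to 0 or 1 as soon as
-- `f 0F` is matched.
vertexCount-suc : ∀ {n} (f : Labeling (suc n)) b →
  vertexCount f b ≡ length (filter (_≟ b) (f 0F ∷ [])) + vertexCount (f ∘ suc) b
vertexCount-suc {n} f b = begin
  length (filter label? (allFin (suc n)))
    ≡⟨ cong (length ∘ filter label?) (allFin-suc n) ⟩
  length (filter label? (0F ∷ map suc (allFin n)))
    ≡⟨ length-filter-++ label? (0F ∷ []) (map suc (allFin n)) ⟩
  length (filter label? (0F ∷ [])) + length (filter label? (map suc (allFin n)))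
    ≡⟨ cong₂ _+_ (sym (length-filter-map (_≟ b) f (0F ∷ []))) (length-filter-map label? suc (allFin n)) ⟩
  length (filter (_≟ b) (f 0F ∷ [])) + vertexCount (f ∘ suc) b ∎
  where
  open ≡-Reasoning
  label? : Decidable (λ v → f v ≡ b)
  label? v = f v ≟ b

vertexCount-total : ∀ {n} (f : Labeling n) → vertexCount f 0F + vertexCount f 1F ≡ n
vertexCount-total {zero}  f = refl
vertexCount-total {suc n} f
  rewrite vertexCount-suc f 0F | vertexCount-suc f 1F
  with f 0F
... | 0F = cong suc (vertexCount-total (f ∘ suc))
... | 1F = trans (+-suc _ _) (cong suc (vertexCount-total (f ∘ suc)))

-- 2e₁ = 2ab and 2e₀ = a(a − 1) + b(b − 1), added up with all signs positive.
edgeCount-identity : ∀ {n} (f : Labeling n) →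
  let a = vertexCount f 0F; b = vertexCount f 1F
      e₀ = edgeCount (complete n) f 0F; e₁ = edgeCount (complete n) f 1F
  in 2 * e₀ + (a + b) + 2 * (a * b) ≡ 2 * e₁ + (a * a + b * b)
edgeCount-identity {zero}  f = refl
edgeCount-identity {suc n} f
  rewrite vertexCount-suc f 0F | vertexCount-suc f 1F
        | edgeCount-complete-suc f 0F | edgeCount-complete-suc f 1F
  with f 0F
-- The new vertex brings a edges labeled 0 and b edges labeled 1, and both sides of the identity
-- grow by 2a + 2b + 1.
... | 0F rewrite starCount₀ (f ∘ suc) 0F | starCount₀ (f ∘ suc) 1F =
  trans (left a b e₀) (trans
    (cong (_+ (2 * a + 2 * b + 1)) (edgeCount-identity (f ∘ suc))) (right a b e₁))
  where
  a = vertexCount (f ∘ suc) 0F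
  b = vertexCount (f ∘ suc) 1F
  e₀ = edgeCount (complete n) (f ∘ suc) 0F
  e₁ = edgeCount (complete n) (f ∘ suc) 1F
  left : ∀ a b e → 2 * (a + e) + (1 + a + (0 + b)) + 2 * ((1 + a) * (0 + b)) ≡
                   2 * e + (a + b) + 2 * (a * b) + (2 * a + 2 * b + 1)
  left = solve-∀
  right : ∀ a b e → 2 * e + (a * a + b * b) + (2 * a + 2 * b + 1) ≡
                    2 * (b + e) + ((1 + a) * (1 + a) + (0 + b) * (0 + b))
  right = solve-∀
-- Now a and b trade roles, with the same growth 2a + 2b + 1.
... | 1F rewrite starCount₁ (f ∘ suc) 0F | starCount₁ (f ∘ suc) 1F =
  trans (left a b e₀) (trans
    (cong (_+ (2 * a + 2 * b + 1)) (edgeCount-identity (f ∘ suc))) (right a b e₁))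
  where
  a = vertexCount (f ∘ suc) 0F
  b = vertexCount (f ∘ suc) 1F
  e₀ = edgeCount (complete n) (f ∘ suc) 0F
  e₁ = edgeCount (complete n) (f ∘ suc) 1F
  left : ∀ a b e → 2 * (b + e) + (0 + a + (1 + b)) + 2 * ((0 + a) * (1 + b)) ≡
                   2 * e + (a + b) + 2 * (a * b) + (2 * a + 2 * b + 1)
  left = solve-∀
  right : ∀ a b e → 2 * e + (a * a + b * b) + (2 * a + 2 * b + 1) ≡
                    2 * (a + e) + ((0 + a) * (0 + a) + (1 + b) * (1 + b))
  right = solve-∀

-- The surplus of 1-edges under a friendly labeling.

roughlyEqual-cases : ∀ a b → RoughlyEqual a b → a ≡ b ⊎ a ≡ suc b ⊎ b ≡ suc a
roughlyEqual-cases zero          zero          _ = inj₁ refl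
roughlyEqual-cases zero          (suc zero)    _ = inj₂ (inj₂ refl)
roughlyEqual-cases zero          (suc (suc _)) (s≤s ())
roughlyEqual-cases (suc zero)    zero          _ = inj₂ (inj₁ refl)
roughlyEqual-cases (suc (suc _)) zero          (s≤s ())
roughlyEqual-cases (suc a)       (suc b)       a≈b =
  Sum.map (cong suc) (Sum.map (cong suc) (cong suc)) (roughlyEqual-cases a b a≈b)

-- Rough equality makes (a - b)² equal to 0 or 1, which is exactly the parity of a + b. Each case
-- cancels the quadratic terms common to both sides and then the factor 2.
half-surplus : ∀ a b e₀ e₁ → RoughlyEqual a b →
  2 * e₀ + (a + b) + 2 * (a * b) ≡ 2 * e₁ + (a * a + b * b) →
  e₁ ≡ e₀ + ⌊ a + b /2⌋
half-surplus a b e₀ e₁ a≈b identity with roughlyEqual-cases a b a≈b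
... | inj₁ refl = trans
  (*-cancelˡ-≡ e₁ (e₀ + a) 2 (+-cancelˡ-≡ (2 * (a * a)) _ _
    (trans (right a e₁) (trans (sym identity) (left a e₀)))))
  (cong (e₀ +_) (n≡⌊n+n/2⌋ a))
  where
  left : ∀ a e → 2 * e + (a + a) + 2 * (a * a) ≡ 2 * (a * a) + 2 * (e + a)
  left = solve-∀
  right : ∀ a e → 2 * (a * a) + 2 * e ≡ 2 * e + (a * a + a * a)
  right = solve-∀
... | inj₂ (inj₁ refl) = trans
  (*-cancelˡ-≡ e₁ (e₀ + b) 2 (+-cancelˡ-≡ (2 * (b * b) + 2 * b + 1) _ _
    (trans (right b e₁) (trans (sym identity) (left b e₀)))))
  -- `⌈ m /2⌉` is by definition `⌊ suc m /2⌋`, so the ceiling lemma handles the odd sum.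
  (cong (e₀ +_) (n≡⌈n+n/2⌉ b))
  where
  left : ∀ b e → 2 * e + (suc b + b) + 2 * (suc b * b) ≡ 2 * (b * b) + 2 * b + 1 + 2 * (e + b)
  left = solve-∀
  right : ∀ b e → 2 * (b * b) + 2 * b + 1 + 2 * e ≡ 2 * e + (suc b * suc b + b * b)
  right = solve-∀
... | inj₂ (inj₂ refl) = trans
  (*-cancelˡ-≡ e₁ (e₀ + a) 2 (+-cancelˡ-≡ (2 * (a * a) + 2 * a + 1) _ _
    (trans (right a e₁) (trans (sym identity) (left a e₀)))))
  (cong (e₀ +_) (trans (n≡⌈n+n/2⌉ a) (cong ⌊_/2⌋ (sym (+-suc a a)))))
  where
  left : ∀ a e → 2 * e + (a + suc a) + 2 * (a * suc a) ≡ 2 * (a * a) + 2 * a + 1 + 2 * (e + a)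
  left = solve-∀
  right : ∀ a e → 2 * (a * a) + 2 * a + 1 + 2 * e ≡ 2 * e + (a * a + suc a * suc a)
  right = solve-∀

friendly-surplus : ∀ {n} (f : Labeling n) → Friendly f →
  edgeCount (complete n) f 1F ≡ edgeCount (complete n) f 0F + ⌊ n /2⌋
friendly-surplus {n} f friendly = trans
  (half-surplus (vertexCount f 0F) (vertexCount f 1F)
    (edgeCount (complete n) f 0F) (edgeCount (complete n) f 1F) friendly (edgeCount-identity f))
  (cong (λ k → edgeCount (complete n) f 0F + ⌊ k /2⌋) (vertexCount-total f))

-- The lower bound.

-- Added 1-edges only widen the surplus, so the added 0-edges alone must bring it from `⌊ n /2⌋`
-- down to at most 1.
lowerBound : ∀ {n} (f : Labeling n) → Friendly f →
  ∀ m → CordialAfterAdding (complete n) f m → ⌊ n /2⌋ ∸ 1 ≤ m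
lowerBound {n} f friendly m (es , distinct , length≡m , _ , balanced) = begin
  ⌊ n /2⌋ ∸ 1                                 ≤⟨ ∸-monoˡ-≤ 1 (+-cancelˡ-≤ e₀ _ _ half≤) ⟩
  length (filter label₀? es)                  ≤⟨ length-filter label₀? es ⟩
  length es                                   ≡⟨ length≡m ⟩
  m                                           ∎
  where
  open ≤-Reasoning
  label₀? : Decidable (λ e → edgeLabel f e ≡ 0F)
  label₀? e = edgeLabel f e ≟ 0F
  label₁? : Decidable (λ e → edgeLabel f e ≡ 1F)
  label₁? e = edgeLabel f e ≟ 1F
  e₀ = edgeCount (complete n) f 0F
  e₁ = edgeCount (complete n) f 1F
  G′ = addEdges (complete n) es distinct
  c₀ = length (filter label₀? es)
  half≤ : e₀ + ⌊ n /2⌋ ≤ e₀ + suc c₀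
  half≤ = begin
    e₀ + ⌊ n /2⌋                       ≡⟨ friendly-surplus f friendly ⟨
    e₁                                 ≤⟨ m≤m+n e₁ _ ⟩
    e₁ + length (filter label₁? es)    ≡⟨ length-filter-++ label₁? (edges (complete n)) es ⟨
    edgeCount G′ f 1F                  ≤⟨ m≤n+∣n-m∣ (edgeCount G′ f 1F) (edgeCount G′ f 0F) ⟩
    edgeCount G′ f 0F + ∣ edgeCount G′ f 0F - edgeCount G′ f 1F ∣ ≤⟨ +-monoʳ-≤ _ balanced ⟩
    edgeCount G′ f 0F + 1              ≡⟨ cong (_+ 1) (length-filter-++ label₀? (edges (complete n)) es) ⟩
    e₀ + c₀ + 1                        ≡⟨ +-assoc e₀ c₀ 1 ⟩
    e₀ + (c₀ + 1)                      ≡⟨ cong (e₀ +_) (+-comm c₀ 1) ⟩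
    e₀ + suc c₀                        ∎

-- A friendly labeling that attains the bound.

-- Recursion in steps of two makes `alternating ∘ suc ∘ suc` compute to `alternating`, and each step
-- adds one vertex to both classes.
alternating : ∀ {n} → Labeling n
alternating 0F            = 0F
alternating 1F            = 1F
alternating (suc (suc i)) = alternating i

alternating-vertexCount : ∀ n b →
  vertexCount (alternating {suc (suc n)}) b ≡ suc (vertexCount (alternating {n}) b)
alternating-vertexCount n b = trans
  (trans (vertexCount-suc alternating b) (cong (_ +_) (vertexCount-suc (alternating ∘ suc) b)))
  (one-each b)
  where
  one-each : ∀ b → length (filter (_≟ b) (0F ∷ [])) +
    (length (filter (_≟ b) (1F ∷ [])) + vertexCount (alternating {n}) b) ≡
    suc (vertexCount (alternating {n}) b)
  one-each 0F = refl
  one-each 1F = refl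

alternating-friendly : ∀ n → Friendly (alternating {n})
alternating-friendly zero          = z≤n
alternating-friendly (suc zero)    = s≤s z≤n
-- `∣ suc x - suc y ∣` computes to `∣ x - y ∣`, so the induction hypothesis applies as it stands.
alternating-friendly (suc (suc n)) = subst (_≤ 1)
  (sym (cong₂ ∣_-_∣ (alternating-vertexCount n 0F) (alternating-vertexCount n 1F)))
  (alternating-friendly n)

-- The surplus is k + 1, and k further 0-edges leave exactly 1. Writing the half as `suc k` avoids
-- truncated subtraction.
cordial-adding-0-edges : ∀ {n} (f : Labeling n) → Friendly f →
  ∀ {k} → ⌊ n /2⌋ ≡ suc k → ∀ es → All Distinct es → length es ≡ k →
  All (λ e → edgeLabel f e ≡ 0F) es → CordialAfterAdding (complete n) f k
cordial-adding-0-edges {n} f friendly {k} half es distinct length≡k labels =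
  es , distinct , length≡k , friendly , ≤-reflexive balanced
  where
  open ≡-Reasoning
  e₀ = edgeCount (complete n) f 0F
  G′ = addEdges (complete n) es distinct
  count₀ : edgeCount G′ f 0F ≡ e₀ + k
  count₀ = trans (length-filter-++ _ (edges (complete n)) es)
    (cong (e₀ +_) (trans (cong length (filter-all _ labels)) length≡k))
  count₁ : edgeCount G′ f 1F ≡ e₀ + k + 1
  count₁ = begin
    edgeCount G′ f 1F
      ≡⟨ length-filter-++ _ (edges (complete n)) es ⟩
    edgeCount (complete n) f 1F + length (filter (λ e → edgeLabel f e ≟ 1F) es)
      ≡⟨ cong (λ xs → edgeCount (complete n) f 1F + length xs)
           (filter-none _ (All.map (λ eq₀ eq₁ → 0≢1+n (cong toℕ (trans (sym eq₀) eq₁))) labels)) ⟩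
    edgeCount (complete n) f 1F + 0 ≡⟨ +-identityʳ _ ⟩
    edgeCount (complete n) f 1F     ≡⟨ friendly-surplus f friendly ⟩
    e₀ + ⌊ n /2⌋                    ≡⟨ cong (e₀ +_) (trans half (+-comm 1 k)) ⟩
    e₀ + (k + 1)                    ≡⟨ +-assoc e₀ k 1 ⟨
    e₀ + k + 1                      ∎
  balanced : ∣ edgeCount G′ f 0F - edgeCount G′ f 1F ∣ ≡ 1
  balanced = trans (cong₂ ∣_-_∣ count₀ count₁) (∣m-m+n∣≡n (e₀ + k) 1)

-- Vertices 0 and 2 share a label, but vertex 2 exists only for n ≥ 3; for n ≤ 3
-- no edge is added.
alternating-cordial : ∀ n → n > 1 →
  CordialAfterAdding (complete n) alternating (⌊ n /2⌋ ∸ 1)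
alternating-cordial (suc (suc zero)) _ =
  cordial-adding-0-edges alternating (alternating-friendly 2) refl [] [] refl []
alternating-cordial (suc (suc (suc m))) _ =
  cordial-adding-0-edges alternating (alternating-friendly (3 + m)) refl
    (replicate k (0F , 2F)) (replicate⁺ k (λ ())) (length-replicate k) (replicate⁺ k refl)
  where k = ⌊ suc m /2⌋
alternating-cordial (suc zero) (s≤s ())

theorem2 : ∀ (n : ℕ) → n > 1 → IsCordialEdgeDeficiency (complete n) (⌊ n /2⌋ ∸ 1)
theorem2 n n>1 =
  -- `lowerBound` serves both minima: at `alternating` for the inner one, and at an arbitrary
  -- friendly `f` for the outer one.
  ( alternating , alternating-friendly n
  , alternating-cordial n n>1 , lowerBound alternating (alternating-friendly n) ) ,
  λ m (f , friendly , cordial , _) → lowerBound f friendly m cordial
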